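{- Let $A$ be an inhabited set with decidable equality, let $\mathbf A=A^{\mathbb N}$ be the space of infinite sequences on $A$, let $\mathcal A$ be the ideal completion of the poset of finite sequences on $A$ ordered by prefix, and let $\iota\colon\mathbf A\to\mathcal A$, $\iota(\alpha)=\{\tau\in A^*\mid\tau\prec\alpha\}$. The map $\iota$ is a homeomorphism from $\mathbf A$ to the space of strongly maximal elements of the algebraic dcpo $\mathcal A$ with the relative Scott topology. Moreover, $\iota$ preserves and reflects apartness: $\alpha\mathrel{\#_{\mathbf A}}\beta$ if and only if $\iota(\alpha)\mathrel{\#_{\mathcal A}}\iota(\beta)$ for every two infinite sequences $\alpha,\beta\in\mathbf A$.
   Context: Everything is constructive: neither excluded middle nor choice is assumed. Decidable equality: for all $a,b\in A$, $a=b$ or $a\neq b$. A subset $S$ of a poset is directed if it is inhabited and any two elements of $S$ have an upper bound in $S$. A dcpo is a poset $(D,\sqsubseteq)$ in which every directed subset $S$ has a supremum $\bigsqcup S$. Write $x\ll y$ if for every directed $S$ with $y\sqsubseteq\bigsqcup S$ there is $s\in S$ with $x\sqsubseteq s$. $D$ is continuous if for every $x$ the set $\{y\in D\mid y\ll x\}$ is directed with supremum $x$. A subset $U\subseteq D$ is Scott open if it is an upper set and whenever $\bigsqcup S\in U$ with $S$ directed, some $s\in S$ is in $U$. Two points of $D$ are Hausdorff separated if they have disjoint Scott open neighbourhoods. An element $x$ of a continuous dcpo $D$ is strongly maximal if for every $u,v\in D$ with $u\ll v$, we have $u\ll x$, or $v$ and $x$ are Hausdorff separated. $(A^*,\preceq)$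 is the poset of finite sequences on $A$ ordered by prefix. $\mathcal A$ is its ideal completion: the set of directed lower subsets of $(A^*,\preceq)$ ordered by inclusion, with directed suprema given by unions; it is an algebraic (hence continuous) dcpo. For a finite sequence $\sigma$ and $\alpha\in A^{\mathbb N}$, $\sigma\prec\alpha$ means that $\sigma$ is an initial segment of $\alpha$; $\bar\alpha_n$ is the sequence of the first $n$ elements of $\alpha$. $\mathbf A=A^{\mathbb N}$ has the product topology with $A$ discrete; a basis of opens is given by the sets $\{\alpha\in\mathbf A\mid\sigma\prec\alpha\}$ for $\sigma\in A^*$. Its apartness is $\alpha\mathrel{\#_{\mathbf A}}\beta\iff\exists_{n\in\mathbb N}\,\bar\alpha_n\neq\bar\beta_n$. The relation $\#_{\mathcal A}$ is the intrinsic apartness of $\mathcal A$: $x\mathrel{\#_{\mathcal A}}y$ if there is a Scott open set containing $x$ but not $y$, or one containing $y$ but not $x$. -}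

-- Logic is read as propositions-as-types, predicatively: at a fixed universe
-- level, a "subset" of X is a predicate X → Set i.  Sets carry an explicit
-- equality (Setoid, Poset): sequences are compared pointwise and ideals by mutual
-- inclusion, since neither function nor propositional extensionality is assumed.

module Defs where

open import Data.List.Base using (List; []; _∷_; applyUpTo)
open import Data.List.Relation.Binary.Pointwise using (Pointwise-≡⇒≡; ≡⇒Pointwise-≡)
open import Data.List.Relation.Binary.Prefix.Heterogeneous using (Prefix; []; _∷_)
import Data.List.Relation.Binary.Prefix.Homogeneous.Properties as Prefix
open import Data.Nat.Base using (ℕ; zero; suc; z≤n; s≤s) renaming (_≤_ to _≤ℕ_; _⊔_ to _⊔ℕ_)
open import Data.Nat.Properties using (m≤m⊔n; m≤n⊔m)
open import Data.Product.Base using (∃; ∃-syntax; _×_; _,_; proj₁; proj₂)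
open import Data.Sum.Base using (_⊎_)
open import Data.Unit.Polymorphic.Base using (tt)
open import Function.Base using (_∘_; id; _on_)
open import Function.Structures using (IsInverse)
open import Level using (Level; _⊔_) renaming (suc to lsuc)
open import Relation.Binary.Bundles using (Poset; Setoid)
open import Relation.Binary.PropositionalEquality
  using (_≡_; _≢_; _→-setoid_; refl; sym; trans; cong; cong₂; subst; isEquivalence)
import Relation.Binary.Construct.On as On
open import Relation.Binary.Structures using (IsPartialOrder)
open import Relation.Unary using (Pred; _∈_; _∉_; _⊆_; _≐_; _∩_; _⊥_; _⊢_; ⋃)
open import Relation.Unary.Polymorphic using (U)

private
  variable
    a c c′ i ℓ ℓ′ ℓ₁ ℓ₂ o o′ p p′ : Level

-- Directed subsets are presented as families: only the image of f matters, and
-- a subset S is the family proj₁ : ∃ S → Carrier.  The domains of interest are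
-- large types, so it is the index type I whose size has to be controlled.

module _ (P : Poset c ℓ₁ ℓ₂) where
  open Poset P

  record IsDirected {I : Set i} (f : I → Carrier) : Set (i ⊔ ℓ₂) where
    field
      inhabited  : I
      upperBound : ∀ j k → ∃[ m ] (f j ≤ f m × f k ≤ f m)

  record IsSupremum {I : Set i} (f : I → Carrier) (x : Carrier) : Set (i ⊔ c ⊔ ℓ₂) where
    field
      upper : ∀ j → f j ≤ x
      least : ∀ y → (∀ j → f j ≤ y) → x ≤ y

record DCPO (c ℓ₁ ℓ₂ i : Level) : Set (lsuc (c ⊔ ℓ₁ ⊔ ℓ₂ ⊔ i)) where
  field
    poset : Poset c ℓ₁ ℓ₂

  open Poset poset public

  field
    ⨆            : {I : Set i} (f : I → Carrier) → IsDirected poset f → Carrier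
    ⨆-isSupremum : {I : Set i} (f : I → Carrier) (d : IsDirected poset f) →
                   IsSupremum poset f (⨆ f d)

  infix 4 _≪_
  _≪_ : Carrier → Carrier → Set (c ⊔ ℓ₂ ⊔ lsuc i)
  x ≪ y = {I : Set i} (f : I → Carrier) (d : IsDirected poset f) →
          y ≤ ⨆ f d → ∃[ j ] x ≤ f j

  IsCompact : Carrier → Set (c ⊔ ℓ₂ ⊔ lsuc i)
  IsCompact x = x ≪ x

  IsDirectedWithSupremum : Pred Carrier ℓ → Carrier → Set (c ⊔ ℓ₂ ⊔ ℓ)
  IsDirectedWithSupremum S x =
    IsDirected poset {I = ∃ S} proj₁ × IsSupremum poset {I = ∃ S} proj₁ x

  IsContinuous : Set (c ⊔ ℓ₂ ⊔ lsuc i)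
  IsContinuous = ∀ x → IsDirectedWithSupremum (λ y → y ≪ x) x

  IsAlgebraic : Set (c ⊔ ℓ₂ ⊔ lsuc i)
  IsAlgebraic = ∀ x → IsDirectedWithSupremum (λ y → IsCompact y × y ≤ x) x

  -- Opens are valued in Set i, the level of the index types.  In an ideal
  -- completion this is no restriction on separation or apartness: any Scott open
  -- predicate containing x contains a basic one { y | u ∈ members y } around x.
  record IsScottOpen (V : Pred Carrier i) : Set (c ⊔ ℓ₂ ⊔ lsuc i) where
    field
      isUpper        : ∀ {x y} → x ≤ y → x ∈ V → y ∈ V
      isInaccessible : {I : Set i} (f : I → Carrier) (d : IsDirected poset f) →
                       ⨆ f d ∈ V → ∃[ j ] f j ∈ V

  HausdorffSeparated : Carrier → Carrier → Set (c ⊔ ℓ₂ ⊔ lsuc i)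
  HausdorffSeparated x y =
    ∃[ V ] ∃[ W ] (IsScottOpen V × IsScottOpen W × x ∈ V × y ∈ W × V ⊥ W)

  infix 4 _#_
  _#_ : Carrier → Carrier → Set (c ⊔ ℓ₂ ⊔ lsuc i)
  x # y = ∃[ V ] (IsScottOpen V × ((x ∈ V × y ∉ V) ⊎ (y ∈ V × x ∉ V)))

record ContinuousDCPO (c ℓ₁ ℓ₂ i : Level) : Set (lsuc (c ⊔ ℓ₁ ⊔ ℓ₂ ⊔ i)) where
  field
    dcpo         : DCPO c ℓ₁ ℓ₂ i
    isContinuous : DCPO.IsContinuous dcpo

  open DCPO dcpo public

  IsStronglyMaximal : Pred Carrier (c ⊔ ℓ₂ ⊔ lsuc i)
  IsStronglyMaximal x = ∀ u v → u ≪ v → u ≪ x ⊎ HausdorffSeparated v x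

record Space (c ℓ o p : Level) : Set (lsuc (c ⊔ ℓ ⊔ o ⊔ p)) where
  field
    setoid : Setoid c ℓ

  open Setoid setoid public using (Carrier; _≈_)

  field
    IsOpen   : Pred Carrier o → Set p
    open-≈   : ∀ {V x y} → IsOpen V → x ≈ y → x ∈ V → y ∈ V
    open-≐   : ∀ {V W} → V ≐ W → IsOpen V → IsOpen W
    open-U   : IsOpen U
    open-∩   : ∀ {V W} → IsOpen V → IsOpen W → IsOpen (V ∩ W)
    open-⋃   : {I : Set o} (V : I → Pred Carrier o) → (∀ j → IsOpen (V j)) → IsOpen (⋃ I V)

IsContinuousMap : (X : Space c ℓ o p) (Y : Space c′ ℓ′ o p′) →
                  (Space.Carrier X → Space.Carrier Y) → Set (c′ ⊔ lsuc o ⊔ p ⊔ p′)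
IsContinuousMap X Y f = ∀ V → Space.IsOpen Y V → Space.IsOpen X (f ⊢ V)

record IsHomeomorphism (X : Space c ℓ o p) (Y : Space c′ ℓ′ o p′)
                       (f : Space.Carrier X → Space.Carrier Y) :
                       Set (c ⊔ ℓ ⊔ p ⊔ c′ ⊔ ℓ′ ⊔ p′ ⊔ lsuc o) where
  field
    f⁻¹            : Space.Carrier Y → Space.Carrier X
    isInverse      : IsInverse (Space._≈_ X) (Space._≈_ Y) f f⁻¹
    continuous     : IsContinuousMap X Y f
    f⁻¹-continuous : IsContinuousMap Y X f⁻¹

subspace : (X : Space c ℓ o p) → Pred (Space.Carrier X) ℓ′ → Space (c ⊔ ℓ′) ℓ o (c ⊔ ℓ′ ⊔ p ⊔ lsuc o)
subspace X S = record
  { setoid = On.setoid {B = ∃ S} setoid proj₁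
  ; IsOpen = λ V → ∃[ W ] (IsOpen W × V ≐ (proj₁ ⊢ W))
  ; open-≈ = λ (_ , oW , V⊆W , W⊆V) x≈y x∈V → W⊆V (open-≈ oW x≈y (V⊆W x∈V))
  ; open-≐ = λ (V⊆V′ , V′⊆V) (W , oW , V⊆W , W⊆V) →
      W , oW , V⊆W ∘ V′⊆V , V⊆V′ ∘ W⊆V
  ; open-U = U , open-U , id , id
  ; open-∩ = λ (W , oW , V⊆W , W⊆V) (W′ , oW′ , V′⊆W′ , W′⊆V′) →
      W ∩ W′ , open-∩ oW oW′ ,
      (λ (x∈V , x∈V′) → V⊆W x∈V , V′⊆W′ x∈V′) ,
      (λ (x∈W , x∈W′) → W⊆V x∈W , W′⊆V′ x∈W′)
  ; open-⋃ = λ V oV →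
      ⋃ _ (λ j → proj₁ (oV j)) ,
      open-⋃ (λ j → proj₁ (oV j)) (λ j → proj₁ (proj₂ (oV j))) ,
      (λ (j , x∈V) → j , proj₁ (proj₂ (proj₂ (oV j))) x∈V) ,
      (λ (j , x∈W) → j , proj₂ (proj₂ (proj₂ (oV j))) x∈W)
  }
  where open Space X

scottSpace : DCPO c ℓ₁ ℓ₂ i → Space c ℓ₁ i (c ⊔ ℓ₂ ⊔ lsuc i)
scottSpace D = record
  { setoid = record { isEquivalence = IsPartialOrder.isEquivalence isPartialOrder }
  ; IsOpen = IsScottOpen
  ; open-≈ = λ oV x≈y → isUpper oV (reflexive x≈y)
  ; open-≐ = λ (V⊆W , W⊆V) oV → record
      { isUpper        = λ x≤y x∈W → V⊆W (isUpper oV x≤y (W⊆V x∈W))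
      ; isInaccessible = λ f d s∈W →
          let (j , fj∈V) = isInaccessible oV f d (W⊆V s∈W) in j , V⊆W fj∈V
      }
  ; open-U = record
      { isUpper        = λ _ _ → tt
      ; isInaccessible = λ f d _ → IsDirected.inhabited d , tt
      }
  ; open-∩ = λ oV oW → record
      { isUpper        = λ x≤y (x∈V , x∈W) → isUpper oV x≤y x∈V , isUpper oW x≤y x∈W
      ; isInaccessible = λ f d (s∈V , s∈W) →
          let (j , fj∈V)          = isInaccessible oV f d s∈V
              (k , fk∈W)          = isInaccessible oW f d s∈W
              (m , fj≤fm , fk≤fm) = IsDirected.upperBound d j k
          in m , isUpper oV fj≤fm fj∈V , isUpper oW fk≤fm fk∈W
      }
  ; open-⋃ = λ V oV → record
      { isUpper        = λ x≤y (j , x∈V) → j , isUpper (oV j) x≤y x∈V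
      ; isInaccessible = λ f d (j , s∈V) →
          let (k , fk∈V) = isInaccessible (oV j) f d s∈V in k , j , fk∈V
      }
  }
  where
  open DCPO D
  open IsScottOpen

stronglyMaximalSpace : (D : ContinuousDCPO c ℓ₁ ℓ₂ i) →
                       Space (c ⊔ ℓ₂ ⊔ lsuc i) ℓ₁ i (c ⊔ ℓ₂ ⊔ lsuc i)
stronglyMaximalSpace D = subspace (scottSpace dcpo) IsStronglyMaximal
  where open ContinuousDCPO D

module IdealCompletion (P : Poset a ℓ a) where
  private module P = Poset P

  record Ideal : Set (lsuc a ⊔ ℓ) where
    field
      members    : Pred P.Carrier a
      isLower    : ∀ {x y} → x P.≤ y → y ∈ members → x ∈ members
      isDirected : IsDirected P {I = ∃ members} proj₁

  open Ideal public

  ideals : Poset (lsuc a ⊔ ℓ) a a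
  ideals = record
    { Carrier        = Ideal
    ; _≈_            = _≐_ on members
    ; _≤_            = λ x y → members x ⊆ members y
    ; isPartialOrder = record
      { isPreorder = record
        { isEquivalence = record
          { refl  = id , id
          ; sym   = λ (f , g) → g , f
          ; trans = λ (f , g) (f′ , g′) → f′ ∘ f , g ∘ g′
          }
        ; reflexive = proj₁
        ; trans     = λ f g → g ∘ f
        }
      ; antisym = _,_
      }
    }

  union : {I : Set a} (f : I → Ideal) → IsDirected ideals f → Ideal
  union {I} f d = record
    { members    = ⋃ I (members ∘ f)
    ; isLower    = λ x≤y (j , y∈fj) → j , isLower (f j) x≤y y∈fj
    ; isDirected = record
      { inhabited  =
          let j         = inhabited d
              (x , x∈)  = inhabited (isDirected (f j))
          in x , j , x∈
      ; upperBound = λ (x , j , x∈fj) (y , k , y∈fk) →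
          let (m , fj⊆fm , fk⊆fm)       = upperBound d j k
              ((z , z∈fm) , x≤z , y≤z)  =
                upperBound (isDirected (f m)) (x , fj⊆fm x∈fj) (y , fk⊆fm y∈fk)
          in (z , m , z∈fm) , x≤z , y≤z
      }
    }
    where open IsDirected

  dcpo : DCPO (lsuc a ⊔ ℓ) a a a
  dcpo = record
    { poset        = ideals
    ; ⨆            = union
    ; ⨆-isSupremum = λ f d → record
      { upper = λ j x∈fj → j , x∈fj
      ; least = λ y f≤y (j , x∈fj) → f≤y j x∈fj
      }
    }

  open DCPO dcpo using (_≪_; IsCompact; IsContinuous; IsAlgebraic)

  ↓_ : P.Carrier → Ideal
  ↓ x = record
    { members    = λ y → y P.≤ x
    ; isLower    = P.trans
    ; isDirected = record
      { inhabited  = x , P.refl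
      ; upperBound = λ (_ , y≤x) (_ , z≤x) → (x , P.refl) , y≤x , z≤x
      }
    }

  private
    ↓-least : ∀ x {u} → u ∈ members x → members (↓ u) ⊆ members x
    ↓-least x u∈x v≤u = isLower x v≤u u∈x

    ↓≪ : ∀ {u} x → u ∈ members x → ↓ u ≪ x
    ↓≪ x u∈x f d x⊆⋃f = let (j , u∈fj) = x⊆⋃f u∈x in j , ↓-least (f j) u∈fj

    principals : (x : Ideal) → ∃ (members x) → Ideal
    principals x (u , _) = ↓ u

    principals-directed : ∀ x → IsDirected ideals (principals x)
    principals-directed x = record
      { inhabited  = inhabited
      ; upperBound = λ u v →
          let (w , u≤w , v≤w) = upperBound u v
          in w , (λ z≤u → P.trans z≤u u≤w) , (λ z≤v → P.trans z≤v v≤w)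
      }
      where open IsDirected (isDirected x)

    ≪⇒principal : ∀ {x y} → y ≪ x → ∃[ u ] members y ⊆ members (principals x u)
    ≪⇒principal {x} y≪x =
      y≪x (principals x) (principals-directed x) (λ {u} u∈x → (u , u∈x) , P.refl)

    compact⇒≪ : ∀ {x y} → IsCompact y → members y ⊆ members x → y ≪ x
    compact⇒≪ y≪y y⊆x f d x⊆⋃f = y≪y f d (λ u∈y → x⊆⋃f (y⊆x u∈y))

    ≪⇒⊆ : ∀ {x y} → y ≪ x → members y ⊆ members x
    ≪⇒⊆ {x} {y} y≪x = let ((_ , u∈x) , y⊆↓u) = ≪⇒principal {x} {y} y≪x in ↓-least x u∈x ∘ y⊆↓u

  isContinuous : IsContinuous
  isContinuous x = record
    { inhabited  = let (u , u∈x) = inhabited in ↓ u , ↓≪ x u∈x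
    ; upperBound = λ (y , y≪x) (z , z≪x) →
        let (u , y⊆↓u) = ≪⇒principal {x} {y} y≪x
            (v , z⊆↓v) = ≪⇒principal {x} {z} z≪x
            ((w , w∈x) , u≤w , v≤w) = upperBound u v
        in (↓ w , ↓≪ x w∈x) ,
           (λ t∈y → P.trans (y⊆↓u t∈y) u≤w) , (λ t∈z → P.trans (z⊆↓v t∈z) v≤w)
    } , record
    { upper = λ (y , y≪x) → ≪⇒⊆ {x} {y} y≪x
    ; least = λ y ≪x⊆y {u} u∈x → ≪x⊆y (↓ u , ↓≪ x u∈x) P.refl
    }
    where open IsDirected (isDirected x)

  isAlgebraic : IsAlgebraic
  isAlgebraic x = record
    { inhabited  = let (u , u∈x) = inhabited in compact u u∈x
    ; upperBound = λ (y , y≪y , y⊆x) (z , z≪z , z⊆x) →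
        let (u , y⊆↓u) = ≪⇒principal {x} {y} (compact⇒≪ {x} {y} y≪y y⊆x)
            (v , z⊆↓v) = ≪⇒principal {x} {z} (compact⇒≪ {x} {z} z≪z z⊆x)
            ((w , w∈x) , u≤w , v≤w) = upperBound u v
        in compact w w∈x ,
           (λ t∈y → P.trans (y⊆↓u t∈y) u≤w) , (λ t∈z → P.trans (z⊆↓v t∈z) v≤w)
    } , record
    { upper = λ (y , _ , y⊆x) → y⊆x
    ; least = λ y c⊆y {u} u∈x → c⊆y (compact u u∈x) P.refl
    }
    where
    open IsDirected (isDirected x)

    compact : ∀ u → u ∈ members x → ∃[ y ] (IsCompact y × members y ⊆ members x)
    compact u u∈x = ↓ u , ↓≪ (↓ u) P.refl , ↓-least x u∈x

  continuousDCPO : ContinuousDCPO (lsuc a ⊔ ℓ) a a a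
  continuousDCPO = record { dcpo = dcpo ; isContinuous = isContinuous }

prefixPoset : Set a → Poset a a a
prefixPoset A = record
  { Carrier        = List A
  ; _≈_            = _≡_
  ; _≤_            = Prefix _≡_
  ; isPartialOrder = record
    { isPreorder = record
      { isEquivalence = isEquivalence
      ; reflexive     = λ eq → PO.reflexive (≡⇒Pointwise-≡ eq)
      ; trans         = PO.trans
      }
    ; antisym = λ σ≤τ τ≤σ → Pointwise-≡⇒≡ (PO.antisym σ≤τ τ≤σ)
    }
  }
  where
  open import Relation.Binary.PropositionalEquality.Properties using (isPartialOrder)
  module PO = IsPartialOrder (Prefix.isPartialOrder (isPartialOrder {A = A}))

module _ {A : Set a} where

  infix 8 _↾_
  _↾_ : (ℕ → A) → ℕ → List A
  α ↾ n = applyUpTo α n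

  infix 4 _≺_
  _≺_ : List A → (ℕ → A) → Set a
  σ ≺ α = ∃[ n ] σ ≡ α ↾ n

  infix 4 _#ˢ_
  _#ˢ_ : (ℕ → A) → (ℕ → A) → Set a
  α #ˢ β = ∃[ n ] α ↾ n ≢ β ↾ n

  ↾-cong : ∀ {α β : ℕ → A} → (∀ n → α n ≡ β n) → ∀ n → α ↾ n ≡ β ↾ n
  ↾-cong α≗β zero    = refl
  ↾-cong α≗β (suc n) = cong₂ _∷_ (α≗β zero) (↾-cong (α≗β ∘ suc) n)

  ↾-mono : ∀ (α : ℕ → A) {m n} → m ≤ℕ n → Prefix _≡_ (α ↾ m) (α ↾ n)
  ↾-mono α z≤n       = []
  ↾-mono α (s≤s m≤n) = refl ∷ ↾-mono (α ∘ suc) m≤n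

  prefix-↾ : ∀ (α : ℕ → A) n {σ} → Prefix _≡_ σ (α ↾ n) → σ ≺ α
  prefix-↾ α zero    []          = zero , refl
  prefix-↾ α (suc n) []          = zero , refl
  prefix-↾ α (suc n) (refl ∷ σ≤) =
    let (m , eq) = prefix-↾ (α ∘ suc) n σ≤ in suc m , cong (α zero ∷_) eq

  shorten : ∀ (α : ℕ → A) {m n σ} {β : ℕ → A} →
            m ≤ℕ n → σ ≡ α ↾ m → α ↾ n ≺ β → σ ≺ β
  shorten α {β = β} m≤n refl (k , eq) =
    prefix-↾ β k (subst (Prefix _≡_ _) eq (↾-mono α m≤n))

sequenceSpace : Set a → Space a a a a
sequenceSpace A = record
  { setoid = ℕ →-setoid A
  ; IsOpen = λ V → ∀ α → α ∈ V → ∃[ σ ] (σ ≺ α × (σ ≺_) ⊆ V)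
  ; open-≈ = λ oV α≗β α∈V →
      let (_ , (n , eq) , σ≺⊆V) = oV _ α∈V in σ≺⊆V (n , trans eq (↾-cong α≗β n))
  ; open-≐ = λ (V⊆W , W⊆V) oV α α∈W →
      let (σ , σ≺α , σ≺⊆V) = oV α (W⊆V α∈W) in σ , σ≺α , λ σ≺β → V⊆W (σ≺⊆V σ≺β)
  ; open-U = λ α _ → [] , (zero , refl) , λ _ → tt
  ; open-∩ = λ oV oW α (α∈V , α∈W) →
      let (_ , (m , eq) , σ≺⊆V) = oV α α∈V
          (_ , (n , eq′) , τ≺⊆W) = oW α α∈W
      in α ↾ (m ⊔ℕ n) , (m ⊔ℕ n , refl) , λ α↾≺β →
           σ≺⊆V (shorten α (m≤m⊔n m n) eq α↾≺β) , τ≺⊆W (shorten α (m≤n⊔m m n) eq′ α↾≺β)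
  ; open-⋃ = λ V oV α (j , α∈V) →
      let (σ , σ≺α , σ≺⊆V) = oV j α α∈V in σ , σ≺α , λ σ≺β → j , σ≺⊆V σ≺β
  }

sequenceDomain : Set a → ContinuousDCPO (lsuc a) a a a
sequenceDomain A = IdealCompletion.continuousDCPO (prefixPoset A)

ι : {A : Set a} → (ℕ → A) → ContinuousDCPO.Carrier (sequenceDomain A)
ι α = record
  { members    = λ τ → τ ≺ α
  ; isLower    = λ { σ≤τ (n , refl) → prefix-↾ α n σ≤τ }
  ; isDirected = record
    { inhabited  = [] , zero , refl
    ; upperBound = λ { (_ , m , refl) (_ , n , refl) →
        (α ↾ (m ⊔ℕ n) , m ⊔ℕ n , refl) , ↾-mono α (m≤m⊔n m n) , ↾-mono α (m≤n⊔m m n) }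
    }
  }

{-# OPTIONS --safe #-}

-- An ideal of sequences is approximated by its members, so a Scott open set
-- containing an ideal x contains ↓ σ for some σ ∈ x; this gives continuity and both
-- directions of the apartness statement.  Strong maximality of ι α compares a
-- sequence σ with the initial segment of α of the same length.  Conversely, if x is
-- strongly maximal and σ ∈ x, test x against σ ∷ʳ b for a fixed b : A: either
-- σ ∷ʳ b ∈ x, or x is separated from ↓ (σ ∷ʳ b), which forces x to contain a proper
-- extension of σ.  Iterating from [] yields the infinite sequence.
module Submission where

open import Defs
open import Data.Empty using (⊥-elim)
open import Data.List.Base using (List; []; _∷_; _∷ʳ_; length)
open import Data.List.Properties using (length-applyUpTo; applyUpTo-∷ʳ; ∷ʳ-injectiveʳ; ≡-dec)
open import Data.List.Relation.Binary.Prefix.Heterogeneous using (Prefix; []; _∷_)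
open import Data.Nat.Base using (ℕ; zero; suc)
open import Data.Nat.Properties using (suc-injective)
open import Data.Product.Base using (∃; Σ-syntax; ∃-syntax; _×_; _,_; proj₁; proj₂)
open import Data.Sum.Base using (inj₁; inj₂)
open import Function.Base using (_∘_; id)
open import Function.Bundles using (_⇔_; mk⇔)
open import Level using (Level)
open import Relation.Binary.Bundles using (Poset; Setoid)
open import Relation.Binary.Definitions using (DecidableEquality)
open import Relation.Binary.PropositionalEquality
  using (_≡_; _≢_; refl; sym; trans; cong; subst; module ≡-Reasoning)
open import Relation.Nullary using (¬_; yes; no)
open import Relation.Unary using (Pred; _∈_; _⊆_)

private
  variable
    a ℓ : Level

module _ (P : Poset a ℓ a) where
  private module P = Poset P
  open IdealCompletion P
  open DCPO dcpo using (_≪_; IsScottOpen)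

  module _ (x : Ideal) where

    private
      principals : ∃ (members x) → Ideal
      principals (u , _) = ↓ u

      principals-directed : IsDirected ideals principals
      principals-directed = record
        { inhabited  = inhabited
        ; upperBound = λ u v →
            let (w , u≤w , v≤w) = upperBound u v
            in w , (λ z≤u → P.trans z≤u u≤w) , (λ z≤v → P.trans z≤v v≤w)
        }
        where open IsDirected (isDirected x)

      -- An ideal is the directed union of the principal ideals of its members, so way-below and
      -- Scott openness can be tested on this one family.
      x⊆⋃principals : members x ⊆ members (union principals principals-directed)
      x⊆⋃principals {u} u∈x = (u , u∈x) , P.refl

    ≪⇒⊆↓ : ∀ {y} → y ≪ x → ∃[ u ] (u ∈ members x × members y ⊆ members (↓ u))
    ≪⇒⊆↓ y≪x =
      let ((u , u∈x) , y⊆↓u) = y≪x principals principals-directed x⊆⋃principals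
      in u , u∈x , y⊆↓u

    -- Directed suprema are unions, so a family covering `x` has an ideal containing `u`, hence all
    -- of `↓ u`. With `≪⇒⊆↓` this characterises way-below through members.
    ⊆↓⇒≪ : ∀ {y u} → u ∈ members x → members y ⊆ members (↓ u) → y ≪ x
    ⊆↓⇒≪ u∈x y⊆↓u f d x⊆⋃f =
      let (j , u∈fj) = x⊆⋃f u∈x in j , λ v∈y → isLower (f j) (y⊆↓u v∈y) u∈fj

    scottOpen⇒↓ : ∀ {V} → IsScottOpen V → x ∈ V → ∃[ u ] (u ∈ members x × (↓ u) ∈ V)
    scottOpen⇒↓ oV x∈V =
      let ((u , u∈x) , ↓u∈V) = isInaccessible principals principals-directed
                                 (isUpper {x} {union principals principals-directed}
                                          x⊆⋃principals x∈V)
      in u , u∈x , ↓u∈V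
      where open IsScottOpen oV

  ⋃∋-isScottOpen : (S : Pred P.Carrier a) →
                   IsScottOpen (λ x → ∃[ u ] (u ∈ members x × u ∈ S))
  ⋃∋-isScottOpen S = record
    { isUpper        = λ x⊆y (u , u∈x , u∈S) → u , x⊆y u∈x , u∈S
    ; isInaccessible = λ f d (u , (j , u∈fj) , u∈S) → j , u , u∈fj , u∈S
    }

  ∋-isScottOpen : ∀ u → IsScottOpen (λ x → u ∈ members x)
  ∋-isScottOpen u = record
    { isUpper        = λ x⊆y → x⊆y
    ; isInaccessible = λ f d u∈⋃f → u∈⋃f
    }

module _ {A : Set a} where

  open IdealCompletion (prefixPoset A) using (Ideal; members; isLower; isDirected; ↓_)
  open ContinuousDCPO (sequenceDomain A)
    using (_#_; IsScottOpen; IsStronglyMaximal)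
  open Poset (prefixPoset A) using () renaming (refl to prefix-refl; trans to prefix-trans)

  prefix-unique : ∀ {σ τ ρ : List A} → Prefix _≡_ σ ρ → Prefix _≡_ τ ρ →
                  length σ ≡ length τ → σ ≡ τ
  prefix-unique []          []          _  = refl
  prefix-unique (refl ∷ σ≤) (refl ∷ τ≤) eq =
    cong (_ ∷_) (prefix-unique σ≤ τ≤ (suc-injective eq))

  -- Directedness puts both members below a common extension, whose prefixes are determined by their
  -- length.
  members-unique : ∀ (x : Ideal) {σ τ} → σ ∈ members x → τ ∈ members x →
                   length σ ≡ length τ → σ ≡ τ
  members-unique x {σ} {τ} σ∈x τ∈x =
    let (_ , σ≤ρ , τ≤ρ) = IsDirected.upperBound (isDirected x) (σ , σ∈x) (τ , τ∈x)
    in prefix-unique σ≤ρ τ≤ρ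

  ≺⇒≡↾ : ∀ {σ} {α : ℕ → A} → σ ≺ α → σ ≡ α ↾ length σ
  ≺⇒≡↾ {α = α} (n , refl) = cong (α ↾_) (sym (length-applyUpTo α n))

  ↾≺⇒≡ : ∀ (α : ℕ → A) {β} n → α ↾ n ≺ β → α ↾ n ≡ β ↾ n
  ↾≺⇒≡ α {β} n α↾n≺β = trans (≺⇒≡↾ α↾n≺β) (cong (β ↾_) (length-applyUpTo α n))

  -- Initial segments of length `suc n` must agree, and their last entries are the values at `n`.
  ι-reflects-⊆ : ∀ {α β : ℕ → A} → members (ι α) ⊆ members (ι β) → ∀ n → α n ≡ β n
  ι-reflects-⊆ {α} {β} ια⊆ιβ n = ∷ʳ-injectiveʳ (α ↾ n) (β ↾ n) (begin
    α ↾ n ∷ʳ α n  ≡⟨ applyUpTo-∷ʳ α n ⟩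
    α ↾ suc n     ≡⟨ ↾≺⇒≡ α (suc n) (ια⊆ιβ (suc n , refl)) ⟩
    β ↾ suc n     ≡⟨ applyUpTo-∷ʳ β n ⟨
    β ↾ n ∷ʳ β n  ∎)
    where open ≡-Reasoning

  ι-cong : ∀ {α β : ℕ → A} → (∀ n → α n ≡ β n) → members (ι α) ⊆ members (ι β)
  ι-cong α≗β (n , eq) = n , trans eq (↾-cong α≗β n)

  ι-isStronglyMaximal : DecidableEquality A → ∀ α → IsStronglyMaximal (ι α)
  ι-isStronglyMaximal _≟_ α u v u≪v with ≪⇒⊆↓ (prefixPoset A) v {u} u≪v
  -- Decidable equality on `A` decides whether `σ` is an initial segment of `α`, which selects the
  -- disjunct.
  ... | σ , σ∈v , u⊆↓σ with ≡-dec _≟_ σ (α ↾ length σ)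
  ... | yes σ≡ = inj₁ (⊆↓⇒≪ (prefixPoset A) (ι α) {u} (length σ , σ≡) u⊆↓σ)
  ... | no  σ≢ = inj₂
    ( (λ x → σ ∈ members x) , (λ x → α ↾ length σ ∈ members x)
    , ∋-isScottOpen (prefixPoset A) σ , ∋-isScottOpen (prefixPoset A) (α ↾ length σ)
    , σ∈v , (length σ , refl)
    -- An ideal in both opens would have two distinct members of equal length.
    , λ {x} (σ∈x , α↾∈x) →
        σ≢ (members-unique x σ∈x α↾∈x (sym (length-applyUpTo α (length σ)))))

  ι-apart : ∀ {α β : ℕ → A} → α #ˢ β ⇔ ι α # ι β
  ι-apart {α} {β} = mk⇔ to from
    where
    to : α #ˢ β → ι α # ι β
    to (n , α↾n≢β↾n) =
      (λ x → α ↾ n ∈ members x) , ∋-isScottOpen (prefixPoset A) (α ↾ n) ,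
      inj₁ ((n , refl) , α↾n≢β↾n ∘ ↾≺⇒≡ α n)

    separated : ∀ {γ δ : ℕ → A} {V} → IsScottOpen V → ι γ ∈ V → ¬ (ι δ ∈ V) →
                ∃[ n ] γ ↾ n ≢ δ ↾ n
    separated {γ} {δ} oV ιγ∈V ιδ∉V =
      let (σ , (n , σ≡γ↾n) , ↓σ∈V) = scottOpen⇒↓ (prefixPoset A) (ι γ) oV ιγ∈V
      -- If the segments agreed, `σ` would belong to `ι δ`, and the upper set `V` would contain
      -- `ι δ` along with `↓ σ`.
      in n , λ γ↾n≡δ↾n →
           ιδ∉V (IsScottOpen.isUpper oV {↓ σ} {ι δ}
             (λ τ≤σ → isLower (ι δ) τ≤σ (n , trans σ≡γ↾n γ↾n≡δ↾n)) ↓σ∈V)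

    from : ι α # ι β → α #ˢ β
    from (V , oV , inj₁ (α∈ , β∉)) = separated oV α∈ β∉
    from (V , oV , inj₂ (β∈ , α∉)) =
      let (n , β↾n≢α↾n) = separated oV β∈ α∉ in n , β↾n≢α↾n ∘ sym

  -- Prefixes of `ρ` are comparable, and `τ` is not below `σ`, so `τ`, and with it `ρ`, is strictly
  -- longer than `σ`; `c` is the entry of `ρ` just after `σ`.
  prefix-extension : ∀ {σ τ ρ : List A} {b} → Prefix _≡_ σ ρ → Prefix _≡_ τ ρ →
                     ¬ Prefix _≡_ τ (σ ∷ʳ b) → ∃[ c ] Prefix _≡_ (σ ∷ʳ c) ρ
  prefix-extension _          []          τ≰ = ⊥-elim (τ≰ [])
  prefix-extension []         (_∷_ {b = c} _ _) _ = c , refl ∷ []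
  prefix-extension (refl ∷ σ≤) (refl ∷ τ≤) τ≰ =
    let (c , σc≤) = prefix-extension σ≤ τ≤ (λ τ≤σb → τ≰ (refl ∷ τ≤σb)) in c , refl ∷ σc≤

  module StronglyMaximal (b : A) (x : Ideal) (x-sm : IsStronglyMaximal x) where

    member-extension : ∀ {σ} → σ ∈ members x → ∃[ c ] σ ∷ʳ c ∈ members x
    member-extension {σ} σ∈x
      with x-sm (↓ (σ ∷ʳ b)) (↓ (σ ∷ʳ b))
             -- Principal ideals are compact, so one ideal can serve as both `u` and `v`.
             (⊆↓⇒≪ (prefixPoset A) (↓ (σ ∷ʳ b)) {↓ (σ ∷ʳ b)} prefix-refl id)
    ... | inj₁ ↓σb≪x =
      let (τ , τ∈x , ↓σb⊆↓τ) = ≪⇒⊆↓ (prefixPoset A) x {↓ (σ ∷ʳ b)} ↓σb≪x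
      in b , isLower x (↓σb⊆↓τ prefix-refl) τ∈x
    ... | inj₂ (V , W , oV , oW , ↓σb∈V , x∈W , V⊥W) =
      let (τ , τ∈x , ↓τ∈W)      = scottOpen⇒↓ (prefixPoset A) x oW x∈W
          -- Otherwise `↓ (σ ∷ʳ b)` lies above `↓ τ` and falls into both `V` and `W`.
          τ≰σb                  = λ τ≤σb → V⊥W (↓σb∈V , IsScottOpen.isUpper oW {↓ τ} {↓ (σ ∷ʳ b)}
                                    (λ ρ≤τ → prefix-trans ρ≤τ τ≤σb) ↓τ∈W)
          ((ρ , ρ∈x) , σ≤ρ , τ≤ρ) =
            IsDirected.upperBound (isDirected x) (σ , σ∈x) (τ , τ∈x)
          (c , σc≤ρ)            = prefix-extension σ≤ρ τ≤ρ τ≰σb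
      in c , isLower x σc≤ρ ρ∈x

    -- Membership is carried along because `member-extension` computes the next entry from it; plain
    -- recursion thus replaces any appeal to choice.
    approximation : ℕ → ∃ (members x)
    approximation zero    = let (_ , σ∈x) = IsDirected.inhabited (isDirected x)
                            in [] , isLower x [] σ∈x
    approximation (suc n) = let (σ , σ∈x) = approximation n
                                (c , σc∈x) = member-extension σ∈x
                            in σ ∷ʳ c , σc∈x

    limit : ℕ → A
    limit n = proj₁ (member-extension (proj₂ (approximation n)))

    limit-↾ : ∀ n → limit ↾ n ≡ proj₁ (approximation n)
    limit-↾ zero    = refl
    limit-↾ (suc n) = trans (sym (applyUpTo-∷ʳ limit n)) (cong (_∷ʳ limit n) (limit-↾ n))

    limit-↾∈ : ∀ n → limit ↾ n ∈ members x
    limit-↾∈ n = subst (_∈ members x) (sym (limit-↾ n)) (proj₂ (approximation n))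

    ι-limit⊆ : members (ι limit) ⊆ members x
    ι-limit⊆ (n , refl) = limit-↾∈ n

    -- The segments of `limit` supply a member of `x` of every length, and `x` has at most one of
    -- each.
    ⊆ι-limit : members x ⊆ members (ι limit)
    ⊆ι-limit {σ} σ∈x = length σ ,
      members-unique x σ∈x (limit-↾∈ (length σ)) (sym (length-applyUpTo limit (length σ)))

  ι-isHomeomorphism : A → (ι-sm : ∀ α → IsStronglyMaximal (ι α)) →
    IsHomeomorphism (sequenceSpace A) (stronglyMaximalSpace (sequenceDomain A))
                    (λ α → ι α , ι-sm α)
  ι-isHomeomorphism b ι-sm = record
    { f⁻¹            = limit
    ; isInverse      = record
      { isLeftInverse = record
        { isCongruent = record
          { cong           = λ α≗β → ι-cong α≗β , ι-cong (sym ∘ α≗β)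
          ; isEquivalence₁ = Setoid.isEquivalence (Space.setoid (sequenceSpace A))
          ; isEquivalence₂ = Setoid.isEquivalence (Space.setoid (stronglyMaximalSpace (sequenceDomain A)))
          }
        ; from-cong = λ {x} {y} (x⊆y , _) →
            ι-reflects-⊆ (⊆ι-limit y ∘ x⊆y ∘ ι-limit⊆ x)
        ; inverseˡ  = λ {x} α≗limit →
            ι-limit⊆ x ∘ ι-cong α≗limit , ι-cong (sym ∘ α≗limit) ∘ ⊆ι-limit x
        }
      ; inverseʳ = λ {α} {x} (x⊆ια , _) → ι-reflects-⊆ (x⊆ια ∘ ι-limit⊆ x)
      }
    ; continuous     = λ V (W , oW , V⊆W , W⊆V) α α∈V →
        let (σ , σ≺α , ↓σ∈W) = scottOpen⇒↓ (prefixPoset A) (ι α) oW (V⊆W α∈V)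
        -- Every `β` extending `σ` has `↓ σ` below `ι β`, so the whole cylinder of `σ` is mapped
        -- into `W`.
        in σ , σ≺α , λ {β} σ≺β → W⊆V (IsScottOpen.isUpper oW {↓ σ} {ι β}
             (λ τ≤σ → isLower (ι β) τ≤σ σ≺β) ↓σ∈W)
    ; f⁻¹-continuous = λ V oV →
        -- The union of the basic Scott opens given by those `σ` whose cylinder lies in `V`; on
        -- strongly maximal elements it is the preimage of `V` under `limit`.
        (λ x → ∃[ σ ] (σ ∈ members x × (σ ≺_) ⊆ V)) ,
        ⋃∋-isScottOpen (prefixPoset A) (λ σ → (σ ≺_) ⊆ V) ,
        (λ {x} limit∈V → let (σ , σ≺ , σ≺⊆V) = oV (limit x) limit∈V
                         in σ , ι-limit⊆ x σ≺ , σ≺⊆V) ,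
        (λ {x} (σ , σ∈x , σ≺⊆V) → σ≺⊆V (⊆ι-limit x σ∈x))
    }
    where
    limit    = λ (x , x-sm) → StronglyMaximal.limit b x x-sm
    ι-limit⊆ = λ ((x , x-sm) : ∃ IsStronglyMaximal) {σ} → StronglyMaximal.ι-limit⊆ b x x-sm {σ}
    ⊆ι-limit = λ ((x , x-sm) : ∃ IsStronglyMaximal) {σ} → StronglyMaximal.⊆ι-limit b x x-sm {σ}

theorem7p9 : ∀ {a} {A : Set a} → A → DecidableEquality A →
    (Σ[ ι-sm ∈ (∀ (α : ℕ → A) → ContinuousDCPO.IsStronglyMaximal (sequenceDomain A) (ι α)) ]
    IsHomeomorphism (sequenceSpace A) (stronglyMaximalSpace (sequenceDomain A))
    (λ α → ι α , ι-sm α))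
    × (∀ (α β : ℕ → A) → α #ˢ β ⇔ ContinuousDCPO._#_ (sequenceDomain A) (ι α) (ι β))
theorem7p9 b _≟_ =
  (ι-isStronglyMaximal _≟_ , ι-isHomeomorphism b (ι-isStronglyMaximal _≟_)) ,
  λ α β → ι-apart
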